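{- Let $A$ be a meet-semilattice and $\kappa$ a regular cardinal. Then $A$ is a complete lattice that is a $\kappa$-frame if and only if $\mathcal{BL}_\kappa(\mathcal{DM} A)=A$.
   Context: $\mathcal{DM} A$ is the complete lattice of normal ideals of $A$. An existing join $\bigvee S$ is distributive if $a\wedge\bigvee S=\bigvee\{a\wedge s:s\in S\}$ for all $a$. $\mathcal{BL} A$ is the frame of D-ideals of $A$ (downsets containing $\bigvee S$ for every subset $S$ with distributive join), and $A$ is identified with $\{{\downarrow}a:a\in A\}\subseteq\mathcal{DM} A\subseteq\mathcal{BL} A$. $\mathcal{BL}_\kappa(\mathcal{DM} A)$ is the sub-$\kappa$-frame of $\mathcal{BL} A$ generated by $\mathcal{DM} A$ (closure under finite meets and joins of fewer than $\kappa$ elements computed in $\mathcal{BL} A$). A $\kappa$-frame is a meet-semilattice in which all joins of fewer than $\kappa$ elements exist and are distributive. -}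

module Defs where

open import Data.Fin.Base using (Fin)
open import Data.Nat.Base using (ℕ)
open import Data.Product.Base using (Σ; ∃; _×_; _,_; proj₁; proj₂)
open import Function.Base using (id)
open import Function.Bundles using (_↣_)
open import Function.Definitions using (Injective)
open import Level using (Level; _⊔_; suc)
open import Relation.Binary.Bundles using (Poset)
open import Relation.Binary.Lattice.Bundles using (MeetSemilattice)
open import Relation.Binary.PropositionalEquality.Core using (_≡_)
open import Relation.Nullary.Negation.Core using (¬_)
open import Relation.Unary using (Pred; _∈_; _⊆_; _≐_)
open import Relation.Unary.Relation.Binary.Subset using (⊆-poset)
import Relation.Binary.Construct.On as On

private
  variable
    ℓ i c ℓ₁ ℓ₂ s : Level

-- A cardinal is represented by a type of that cardinality, and a single
-- universe Set ℓ plays the role of the universe of sets.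

infix 4 _≺_

_≺_ : Set ℓ → Set ℓ → Set ℓ
I ≺ K = (I ↣ K) × ¬ (K ↣ I)

-- Regular cardinals are infinite by convention; the disjoint sum Σ I X stands
-- for the union of the sets X j.

record RegularCardinal (ℓ : Level) : Set (suc ℓ) where
  field
    Index    : Set ℓ
    infinite : ℕ ↣ Index
    regular  : (I : Set ℓ) (X : I → Set ℓ) →
               I ≺ Index → (∀ j → X j ≺ Index) → Σ I X ≺ Index

module Bounds (P : Poset c ℓ₁ ℓ₂) where
  open Poset P

  UpperBounds : Pred Carrier s → Pred Carrier (c ⊔ ℓ₂ ⊔ s)
  UpperBounds S x = ∀ {y} → y ∈ S → y ≤ x

  LowerBounds : Pred Carrier s → Pred Carrier (c ⊔ ℓ₂ ⊔ s)
  LowerBounds S x = ∀ {y} → y ∈ S → x ≤ y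

  IsJoin : Pred Carrier s → Carrier → Set (c ⊔ ℓ₂ ⊔ s)
  IsJoin S b = b ∈ UpperBounds S × b ∈ LowerBounds (UpperBounds S)

  IsMeet : Pred Carrier s → Carrier → Set (c ⊔ ℓ₂ ⊔ s)
  IsMeet S b = b ∈ LowerBounds S × b ∈ UpperBounds (LowerBounds S)

  Image : {I : Set i} → (I → Carrier) → Pred Carrier (i ⊔ ℓ₁)
  Image f x = ∃ λ j → f j ≈ x

  IsFinite : Pred Carrier s → Set (c ⊔ ℓ₁ ⊔ s)
  IsFinite S = ∃ λ n → Σ (Fin n → Carrier) λ f → S ≐ Image f

  -- S has fewer than κ elements, counted up to ≈: it is enumerated without
  -- repetition by a type of cardinality less than κ.

  FewerThan : RegularCardinal ℓ → Pred Carrier s → Set (suc ℓ ⊔ c ⊔ ℓ₁ ⊔ s)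
  FewerThan {ℓ} κ S =
    Σ (Set ℓ) λ I → I ≺ RegularCardinal.Index κ ×
      Σ (I → Carrier) λ f → Injective _≡_ _≈_ f × S ≐ Image f

module _ (A : MeetSemilattice ℓ ℓ ℓ) where
  open MeetSemilattice A
  open Bounds poset

  IsCompleteLattice : Set (suc ℓ)
  IsCompleteLattice = (S : Pred Carrier ℓ) → ∃ (IsJoin S) × ∃ (IsMeet S)

  IsDistributiveJoin : Pred Carrier ℓ → Carrier → Set ℓ
  IsDistributiveJoin S b =
    IsJoin S b × (∀ a → IsJoin (λ x → ∃ λ y → y ∈ S × x ≈ a ∧ y) (a ∧ b))

  IsκFrame : RegularCardinal ℓ → Set (suc ℓ)
  IsκFrame κ = (S : Pred Carrier ℓ) → FewerThan κ S → ∃ (IsDistributiveJoin S)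

  record NormalIdeal : Set (suc ℓ) where
    field
      carrier : Pred Carrier ℓ
      normal  : LowerBounds (UpperBounds carrier) ≐ carrier

  record DIdeal : Set (suc ℓ) where
    field
      carrier  : Pred Carrier ℓ
      downward : ∀ {x y} → x ≤ y → y ∈ carrier → x ∈ carrier
      closed   : ∀ {S b} → S ⊆ carrier → IsDistributiveJoin S b → b ∈ carrier

  BL : Poset (suc ℓ) ℓ ℓ
  BL = On.poset (⊆-poset Carrier ℓ) DIdeal.carrier

  ↓_ : Carrier → NormalIdeal
  ↓ a = record
    { carrier = _≤ a
    ; normal  = (λ p → p id) , (λ x≤a u → trans x≤a (u refl))
    }

  normal⇒D : NormalIdeal → DIdeal
  normal⇒D N = record
    { carrier  = carrier
    ; downward = λ x≤y y∈N → proj₁ normal λ u → trans x≤y (u y∈N)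
    ; closed   = λ S⊆N ((_ , least) , _) →
                   proj₁ normal λ u → least λ y∈S → u (S⊆N y∈S)
    }
    where open NormalIdeal N

  open Poset BL using () renaming (_≈_ to _≈ᴮ_)
  module B = Bounds BL

  -- DM A and A, viewed as subsets of BL A.

  DMᴮ : Pred DIdeal (suc ℓ)
  DMᴮ D = ∃ λ N → D ≈ᴮ normal⇒D N

  Aᴮ : Pred DIdeal ℓ
  Aᴮ D = ∃ λ a → D ≈ᴮ normal⇒D (↓ a)

  -- The sub-κ-frame of BL A generated by DM A. The empty meet is the case n = 0
  -- of IsFinite, so the top of BL A is included.

  data BLκDM (κ : RegularCardinal ℓ) : Pred DIdeal (suc ℓ) where
    generator : ∀ {D} → D ∈ DMᴮ → D ∈ BLκDM κ
    meet      : ∀ {D} (S : Pred DIdeal ℓ) → B.IsFinite S → S ⊆ BLκDM κ →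
                B.IsMeet S D → D ∈ BLκDM κ
    join      : ∀ {D} (S : Pred DIdeal ℓ) → B.FewerThan κ S → S ⊆ BLκDM κ →
                B.IsJoin S D → D ∈ BLκDM κ

{-# OPTIONS --safe #-}

-- The D-ideal generated by a subset S is reached in one step: it consists of the
-- x that are the distributive join of {x ∧ s : s ∈ S}, equivalently of the x with
-- a ∧ x ≤ c whenever a ∧ s ≤ c for all s ∈ S. If BLκ(DM A) = A, this D-ideal is
-- principal for every S with fewer than κ elements, and its largest element is the
-- distributive join of S; completeness of A comes from DM A ⊆ A. Conversely, in a
-- complete κ-frame the principal ideals contain DM A and are closed under finite
-- meets and joins of fewer than κ elements in BL A.

module Submission where

open import Defs
open import Data.Product.Base using (∃; _×_; _,_; proj₁; proj₂)
open import Function.Base using (id)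
open import Function.Bundles using (_⇔_; mk⇔)
open import Level using (Level)
open import Relation.Binary.Bundles using (Poset)
open import Relation.Binary.Lattice.Bundles using (MeetSemilattice)
open import Relation.Unary using (Pred; _∈_; _⊆_; _≐_)
import Relation.Binary.Lattice.Properties.MeetSemilattice as MeetSemilatticeProperties

module _ {ℓ : Level} (A : MeetSemilattice ℓ ℓ ℓ) where
  open MeetSemilattice A
  open MeetSemilatticeProperties A using (∧-monotonic; ∧-assoc)
  open Bounds poset
  open Poset (BL A) using () renaming (_≈_ to _≈ᴮ_)

  principal : Carrier → DIdeal A
  principal a = normal⇒D A (↓_ A a)

  principal-injective : ∀ {a b} → principal a ≈ᴮ principal b → a ≈ b
  principal-injective (p , q) = antisym (p refl) (q refl)

  -- Normality is the Galois identity LUL = L for lower and upper bounds.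
  lowerBoundsIdeal : Pred Carrier ℓ → NormalIdeal A
  lowerBoundsIdeal S = record
    { carrier = LowerBounds S
    ; normal  = (λ p y∈S → p λ l → l y∈S) , (λ l u → u l)
    }

  module _ (S : Pred Carrier ℓ) where

    -- This description, unlike the intersection of all D-ideals containing S,
    -- does not quantify over subsets, so it stays in the universe Set ℓ.
    generated : DIdeal A
    generated = record
      { carrier  = λ x → ∀ a c → (∀ {s} → s ∈ S → a ∧ s ≤ c) → a ∧ x ≤ c
      ; downward = λ x≤y y∈ a c h → trans (∧-monotonic refl x≤y) (y∈ a c h)
      ; closed   = λ T⊆ (_ , dist) a c h →
          proj₂ (dist a) λ (_ , y∈T , x≈a∧y) → trans (reflexive x≈a∧y) (T⊆ y∈T a c h)
      }

    ⊆-generated : S ⊆ DIdeal.carrier generated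
    ⊆-generated s∈S _ _ h = h s∈S

    -- Testing `x` against `a = x` gives the join; distributivity comes from testing against `a ∧ x`
    -- and reassociating `(a ∧ x) ∧ s`.
    distributiveJoin-of-meets : ∀ {x} → x ∈ DIdeal.carrier generated →
      IsDistributiveJoin A (λ z → ∃ λ s → s ∈ S × z ≈ x ∧ s) x
    distributiveJoin-of-meets {x} x∈ =
      ( (λ (_ , _ , z≈) → trans (reflexive z≈) (x∧y≤x _ _))
      , (λ {c} u → trans (∧-greatest refl refl) (x∈ x c λ s∈S → u (_ , s∈S , Eq.refl))) ) ,
      λ a →
        (λ (_ , (_ , _ , z≈) , w≈) → trans (reflexive w≈)
          (∧-monotonic refl (trans (reflexive z≈) (x∧y≤x _ _)))) ,
        (λ {c} u → trans (∧-greatest refl (x∧y≤y a x))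
          (x∈ (a ∧ x) c λ s∈S → u (_ , (_ , s∈S , Eq.refl) , ∧-assoc _ _ _)))

    -- The meets `x ∧ s` lie in the downset `D`, and `x` is their distributive join, so a single use
    -- of `closed` suffices.
    generated-least : (D : DIdeal A) → S ⊆ DIdeal.carrier D →
      DIdeal.carrier generated ⊆ DIdeal.carrier D
    generated-least D S⊆D x∈ = closed
      (λ (_ , s∈S , z≈) → downward (trans (reflexive z≈) (x∧y≤y _ _)) (S⊆D s∈S))
      (distributiveJoin-of-meets x∈)
      where open DIdeal D

    principal⇒distributiveJoin : ∀ {b} → generated ≈ᴮ principal b → IsDistributiveJoin A S b
    principal⇒distributiveJoin {b} (J⊆↓b , ↓b⊆J) =
      ( S≤b
      -- Leastness is the test at `a = b`; the tests at arbitrary `a` give distributivity below.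
      , (λ {c} u → trans (∧-greatest refl refl)
          (↓b⊆J refl b c λ s∈S → trans (x∧y≤y _ _) (u s∈S))) ) ,
      λ a →
        (λ (_ , s∈S , x≈) → trans (reflexive x≈) (∧-monotonic refl (S≤b s∈S))) ,
        (λ {c} u → ↓b⊆J refl a c λ s∈S → u (_ , s∈S , Eq.refl))
      where
      S≤b : b ∈ UpperBounds S
      S≤b s∈S = J⊆↓b (⊆-generated s∈S)

  -- The largest element of the normal ideal of lower bounds of `UpperBounds S` is the join of `S`;
  -- that of `LowerBounds S` is the meet.
  DM⊆A⇒complete : DMᴮ A ⊆ Aᴮ A → IsCompleteLattice A
  DM⊆A⇒complete DM⊆A S = join-of-S , meet-of-S
    where
    principal-normal : (N : NormalIdeal A) → ∃ λ b → normal⇒D A N ≈ᴮ principal b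
    principal-normal N = DM⊆A {normal⇒D A N} (N , id , id)

    join-of-S : ∃ (IsJoin S)
    join-of-S =
      let (b , LU⊆↓b , ↓b⊆LU) = principal-normal (lowerBoundsIdeal (UpperBounds S))
      in b , (λ s∈S → LU⊆↓b λ u → u s∈S) , λ u → ↓b⊆LU refl u

    meet-of-S : ∃ (IsMeet S)
    meet-of-S =
      let (m , L⊆↓m , ↓m⊆L) = principal-normal (lowerBoundsIdeal S)
      in m , (λ s∈S → ↓m⊆L refl s∈S) , λ l → L⊆↓m l

  module _ (complete : IsCompleteLattice A) where

    -- The join of a normal ideal lies below all its upper bounds, so normality puts it in the
    -- ideal.
    DM⊆A : DMᴮ A ⊆ Aᴮ A
    DM⊆A (N , D⊆N , N⊆D) =
      let (b , N≤b , b-least) = proj₁ (complete (NormalIdeal.carrier N))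
      in b , (λ x∈D → N≤b (D⊆N x∈D)) ,
         (λ x≤b → N⊆D (proj₁ (NormalIdeal.normal N) λ u → trans x≤b (b-least u)))

    finiteMeet∈A : ∀ {D} (S : Pred (DIdeal A) ℓ) → B.IsFinite A S → S ⊆ Aᴮ A →
      B.IsMeet A S D → D ∈ Aᴮ A
    finiteMeet∈A {D} S (n , f , S⊆f , f⊆S) S⊆A (D≤S , D-greatest) =
      m , (λ x∈D → m-greatest λ (j , aj≈y) → trans
            (proj₁ (fj≈↓aj j) (D≤S (f∈S j) x∈D)) (reflexive aj≈y)) ,
          D-greatest {principal m} (λ E∈S x≤m →
            let (j , fj⊆E , _) = S⊆f E∈S
            in fj⊆E (proj₂ (fj≈↓aj j) (trans x≤m (m≤a (j , Eq.refl)))))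
      where
      f∈S : ∀ j → f j ∈ S
      f∈S j = f⊆S (j , id , id)
      a : ∀ j → Carrier
      a j = proj₁ (S⊆A (f∈S j))
      fj≈↓aj : ∀ j → f j ≈ᴮ principal (a j)
      fj≈↓aj j = proj₂ (S⊆A (f∈S j))
      -- For `n = 0` this is the top of `A`.
      meet-of-a : ∃ (IsMeet (Image a))
      meet-of-a = proj₂ (complete (Image a))
      m : Carrier
      m = proj₁ meet-of-a
      m≤a : m ∈ LowerBounds (Image a)
      m≤a = proj₁ (proj₂ meet-of-a)
      m-greatest : m ∈ UpperBounds (LowerBounds (Image a))
      m-greatest = proj₂ (proj₂ meet-of-a)

  module _ (κ : RegularCardinal ℓ) where

    A⊆BLκDM : Aᴮ A ⊆ BLκDM A κ
    A⊆BLκDM (a , D≈↓a) = generator (↓_ A a , D≈↓a)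

    -- It is the join in `BL A` of the principal ideals of members of `S`. Since `principal` is
    -- injective, the index type `I` still enumerates without repetition.
    generated∈BLκDM : (S : Pred Carrier ℓ) → FewerThan κ S → generated S ∈ BLκDM A κ
    generated∈BLκDM S (I , I≺κ , f , f-inj , S⊆f , f⊆S) = join {D = generated S}
      (B.Image A (λ j → principal (f j)))
      ( I , I≺κ , (λ j → principal (f j))
      , (λ ↓≈↓ → f-inj (principal-injective ↓≈↓)) , id , id )
      (λ (j , ↓fj⊆D , D⊆↓fj) → A⊆BLκDM (f j , D⊆↓fj , ↓fj⊆D))
      ( (λ (j , _ , D⊆↓fj) x∈D →
          downward (D⊆↓fj x∈D) (⊆-generated S (f⊆S (j , Eq.refl))))
      , (λ {D} u → generated-least S D λ s∈S →
          let (j , fj≈s) = S⊆f s∈S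
          in u {principal (f j)} (j , id , id) (reflexive (Eq.sym fj≈s))) )
      where open DIdeal (generated S)

    BLκDM⊆A⇒κFrame : BLκDM A κ ⊆ Aᴮ A → IsκFrame A κ
    BLκDM⊆A⇒κFrame BLκDM⊆A S S<κ =
      let (b , J≈↓b) = BLκDM⊆A (generated∈BLκDM S S<κ)
      in b , principal⇒distributiveJoin S J≈↓b

    module _ (complete : IsCompleteLattice A) (κFrame : IsκFrame A κ) where

      -- Let `b` be the distributive join of the generators `a j`. As a D-ideal containing every
      -- `a j`, `D` contains `b`; as the least upper bound it lies inside `principal b`.
      κJoin∈A : ∀ {D} (S : Pred (DIdeal A) ℓ) → B.FewerThan A κ S → S ⊆ Aᴮ A →
        B.IsJoin A S D → D ∈ Aᴮ A
      κJoin∈A {D} S (I , I≺κ , f , f-inj , S⊆f , f⊆S) S⊆A (S≤D , D-least) =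
        b , D-least {principal b} (λ E∈S x∈E →
              let (j , _ , E⊆fj) = S⊆f E∈S
              in trans (proj₁ (fj≈↓aj j) (E⊆fj x∈E)) (a≤b (j , Eq.refl))) ,
            (λ x≤b → downward x≤b (closed a⊆D b-join))
        where
        open DIdeal D
        f∈S : ∀ j → f j ∈ S
        f∈S j = f⊆S (j , id , id)
        a : ∀ j → Carrier
        a j = proj₁ (S⊆A (f∈S j))
        fj≈↓aj : ∀ j → f j ≈ᴮ principal (a j)
        fj≈↓aj j = proj₂ (S⊆A (f∈S j))
        -- `FewerThan` asks for an enumeration without repetition; this carries that property from
        -- `f` to `a`.
        a-inj : ∀ {i j} → a i ≈ a j → f i ≈ᴮ f j
        a-inj {i} {j} ai≈aj =
          (λ x∈fi → proj₂ (fj≈↓aj j) (trans (proj₁ (fj≈↓aj i) x∈fi) (reflexive ai≈aj))) ,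
          (λ x∈fj → proj₂ (fj≈↓aj i) (trans (proj₁ (fj≈↓aj j) x∈fj) (reflexive (Eq.sym ai≈aj))))
        distributiveJoin-of-a : ∃ (IsDistributiveJoin A (Image a))
        distributiveJoin-of-a =
          κFrame (Image a) (I , I≺κ , a , (λ ai≈aj → f-inj (a-inj ai≈aj)) , id , id)
        b : Carrier
        b = proj₁ distributiveJoin-of-a
        b-join : IsDistributiveJoin A (Image a) b
        b-join = proj₂ distributiveJoin-of-a
        a≤b : b ∈ UpperBounds (Image a)
        a≤b = proj₁ (proj₁ b-join)
        a⊆D : Image a ⊆ carrier
        a⊆D (j , aj≈y) = S≤D (f∈S j) (proj₂ (fj≈↓aj j) (reflexive (Eq.sym aj≈y)))

      BLκDM⊆A : BLκDM A κ ⊆ Aᴮ A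
      BLκDM⊆A {D} (generator D∈DM) = DM⊆A complete {D} D∈DM
      BLκDM⊆A {D} (meet S fin S⊆ isMeet) =
        finiteMeet∈A complete {D} S fin (λ E∈S → BLκDM⊆A (S⊆ E∈S)) isMeet
      BLκDM⊆A {D} (join S S<κ S⊆ isJoin) =
        κJoin∈A {D} S S<κ (λ E∈S → BLκDM⊆A (S⊆ E∈S)) isJoin

theorem4p14 : ∀ {ℓ : Level} (A : MeetSemilattice ℓ ℓ ℓ) (κ : RegularCardinal ℓ) →
    (IsCompleteLattice A × IsκFrame A κ) ⇔ (BLκDM A κ ≐ Aᴮ A)
theorem4p14 A κ = mk⇔
  (λ (complete , κFrame) → BLκDM⊆A A κ complete κFrame , A⊆BLκDM A κ)
  (λ (BLκDM⊆A , _) →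
    DM⊆A⇒complete A (λ {D} D∈DM → BLκDM⊆A {D} (generator D∈DM)) ,
    BLκDM⊆A⇒κFrame A κ BLκDM⊆A)
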